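{- Given an oracle for SAT, the randomized algorithm ApproxMC, run on inputs $F,\varepsilon,\delta$, where $F$ is a propositional CNF formula and $0<\varepsilon\le1$, $0<\delta\le1$, runs in time polynomial in $\log_2(1/\delta)$, $|F|$ and $1/\varepsilon$ relative to the oracle, where $|F|$ denotes the size of $F$.
   Context: "Relative to the oracle" means that each call to the SAT oracle is charged as one step; the oracle, given a propositional formula (a conjunction of CNF clauses and xor constraints), returns a satisfying assignment or reports that none exists. Random bits are available to the algorithm. Hash family. For integers $n\ge1$, $m\ge0$, $H_{xor}(n,m,3)$ is the family of functions $h:\{0,1\}^n\to\{0,1\}^m$ of the form $h(y)[i]=a_{i,0}\oplus\bigoplus_{k=1}^n a_{i,k}\cdot y[k]$ for $1\le i\le m$, with $a_{i,j}\in\{0,1\}$ ($1\le i\le m$, $0\le j\le n$); choosing a function at random from it means choosing all $a_{i,j}$ independently and uniformly. BoundedSAT$(G,r)$: for a propositional formula $G$ (a conjunction of CNF clauses and xor constraints) and an integer $r\ge0$, returns a set $S$ of satisfying assignments of $G$ with $|S|=\min(r,\#G)$, where $\#G$ is the number of satisfying assignments of $G$; it is implemented by at most $r$ calls to the SAT oracle (successively excluding the assignments already found). Algorithm ApproxMCCore$(F,\mathit{pivot})$, where $z_1,\dots,z_n$ are the variables of $F$ (random choices uniform and independent): 1. $S=$ BoundedSAT$(F,\mathit{pivot}+1)$. If $|S|\le\mathit{pivot}$, return $|S|$. 2. Otherwise set $l=\lfloor\log_2(\mathit{pivot})\rfloor-1$ and $i=l-1$, and repeat: increase $i$ by $1$;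 choose $h$ at random from $H_{xor}(n,i-l,3)$; choose $\alpha$ at random from $\{0,1\}^{i-l}$; set $S=$ BoundedSAT$(F\wedge(h(z_1,\dots,z_n)=\alpha),\mathit{pivot}+1)$; until ($1\le|S|\le\mathit{pivot}$) or $i=n$. 3. If $|S|>\mathit{pivot}$ or $|S|=0$, return $\bot$ (failure); otherwise return $|S|\cdot2^{i-l}$. Algorithm ApproxMC$(F,\varepsilon,\delta)$: set $\mathit{pivot}=2\left\lceil 3e^{1/2}\left(1+\frac1\varepsilon\right)^2\right\rceil$ and $t=\lceil35\log_2(3/\delta)\rceil$. Call ApproxMCCore$(F,\mathit{pivot})$ $t$ times independently, and let $C$ be the list of all non-$\bot$ values returned. Return the median of $C$ (and $\bot$ if $C$ is empty). -}

module Defs where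

open import Data.Bool using (Bool; true; false; _∧_; _∨_; _xor_; not; if_then_else_)
open import Data.Bool.ListAction using (any; all)
open import Data.Fin using (Fin; zero; suc)
open import Data.Integer using (+_)
open import Data.List as List using (List; []; _∷_)
open import Data.List.Relation.Unary.Any using (Any)
open import Data.Maybe as Maybe using (Maybe; just; nothing)
open import Data.Nat as ℕ using (ℕ; zero; suc; _∸_; _≤ᵇ_; _≡ᵇ_; ⌊_/2⌋)
open import Data.Nat.Binary as ℕᵇ using (ℕᵇ)
open import Data.Nat.Binary.Properties using () renaming (_≤?_ to _≤?ᵇ_)
open import Data.Nat.Logarithm using (⌊log₂_⌋)
open import Data.Nat.ListAction using (sum)
open import Data.Product using (∃; ∃-syntax; _×_; _,_; proj₁; proj₂)
open import Data.Rational as ℚ using (ℚ; 0ℚ; 1ℚ; ½)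
open import Data.Sum using (_⊎_; inj₁; inj₂)
open import Data.Unit using (⊤; tt)
open import Data.Vec as Vec using (Vec; []; _∷_)
open import Function using (_∘_)
open import Function.Bundles using (_⇔_)
open import Relation.Binary.PropositionalEquality using (_≡_)
open import Relation.Nullary using (¬_; Dec; does)
open import Relation.Nullary.Decidable using (dec⇒maybe)

------------------------------------------------------------------------
-- Real numbers

fromℕ : ℕ → ℚ
fromℕ n = + n ℚ./ 1

_^ℚ_ : ℚ → ℕ → ℚ
q ^ℚ zero  = 1ℚ
q ^ℚ suc n = q ℚ.* (q ^ℚ n)

-- Two-sided Dedekind cuts: lower q means q < x, upper q means x < q.
record ℝ : Set₁ where
  field
    lower upper     : ℚ → Set
    lower-inhabited : ∃ lower
    upper-inhabited : ∃ upper
    lower-rounded   : ∀ q → lower q ⇔ (∃[ r ] q ℚ.< r × lower r)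
    upper-rounded   : ∀ q → upper q ⇔ (∃[ r ] r ℚ.< q × upper r)
    disjoint        : ∀ q → ¬ (lower q × upper q)
    located         : ∀ q r → q ℚ.< r → lower q ⊎ upper r

open ℝ public using (lower; upper)

Positive : ℝ → Set
Positive x = lower x 0ℚ

AtMostOne : ℝ → Set
AtMostOne x = ∀ q → 1ℚ ℚ.< q → upper x q

-- Every real expression below is nonnegative and built from monotone
-- operations, so that it is enough to record the rationals q with x < q.
ℝ≥0 : Set₁
ℝ≥0 = ℚ → Set

infixl 6 _+ᵣ_
infixl 7 _*ᵣ_

nat : ℕ → ℝ≥0
nat n q = fromℕ n ℚ.< q

_+ᵣ_ : ℝ≥0 → ℝ≥0 → ℝ≥0
(x +ᵣ y) q = ∃[ a ] ∃[ b ] x a × y b × a ℚ.+ b ℚ.≤ q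

_*ᵣ_ : ℝ≥0 → ℝ≥0 → ℝ≥0
(x *ᵣ y) q = ∃[ a ] ∃[ b ] x a × y b × a ℚ.* b ℚ.≤ q

-- 1 / x, for positive x: 1 / x < q iff 1 ≤ a q for some rational 0 < a < x.
recip : ℝ → ℝ≥0
recip x q = ∃[ a ] 0ℚ ℚ.< a × lower x a × 1ℚ ℚ.≤ a ℚ.* q

-- log₂ x, for x ≥ 1: log₂ x < q iff there are a rational r > x and a fraction
-- a / (1 + b) ≤ q such that r ≤ 2 ^ (a / (1 + b)).
log₂ : ℝ≥0 → ℝ≥0
log₂ x q = ∃[ r ] ∃[ a ] ∃[ b ]
  x r × r ^ℚ suc b ℚ.≤ fromℕ (2 ℕ.^ a) × fromℕ a ℚ.≤ q ℚ.* fromℕ (suc b)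

-- x ^ j / j !
expTerm : ℚ → ℕ → ℚ
expTerm x zero    = 1ℚ
expTerm x (suc j) = expTerm x j ℚ.* (x ℚ.* (+ 1 ℚ./ suc j))

expSum : ℚ → ℕ → ℚ
expSum x zero    = 0ℚ
expSum x (suc j) = expSum x j ℚ.+ expTerm x j

-- e ^ x for rational x ≥ 0, as the supremum of the partial sums.
exp : ℚ → ℝ≥0
exp x q = ∃[ r ] r ℚ.< q × (∀ j → expSum x j ℚ.≤ r)

infix 4 _≤nat_ _nat≤_

_≤nat_ : ℝ≥0 → ℕ → Set
x ≤nat k = ∀ q → fromℕ k ℚ.< q → x q

_nat≤_ : ℕ → ℝ≥0 → Set
k nat≤ x = ∀ q → x q → fromℕ k ℚ.≤ q

-- IsCeiling x k means k = ⌈ x ⌉.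
IsCeiling : ℝ≥0 → ℕ → Set
IsCeiling x k = x ≤nat k × (∀ j → x ≤nat j → k ℕ.≤ j)

-- True of every (finite) real, but only classically.
HasCeiling : ℝ≥0 → Set
HasCeiling x = ∃ (IsCeiling x)

data Polynomial (k : ℕ) : Set where
  con     : ℕ → Polynomial k
  var     : Fin k → Polynomial k
  _⊕_ _⊗_ : Polynomial k → Polynomial k → Polynomial k

eval : ∀ {k} → Polynomial k → Vec ℝ≥0 k → ℝ≥0
eval (con c) ρ = nat c
eval (var i) ρ = Vec.lookup ρ i
eval (p ⊕ q) ρ = eval p ρ +ᵣ eval q ρ
eval (p ⊗ q) ρ = eval p ρ *ᵣ eval q ρ

------------------------------------------------------------------------
-- Formulas in n variables

-- (true , v) is the literal v, (false , v) is its negation.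
Literal : ℕ → Set
Literal n = Bool × Fin n

Clause : ℕ → Set
Clause n = List (Literal n)

CNF : ℕ → Set
CNF n = List (Clause n)

data Constraint (n : ℕ) : Set where
  clause : Clause n → Constraint n
  -- the sum modulo 2 of the listed variables equals the given bit
  parity : List (Fin n) → Bool → Constraint n

Formula : ℕ → Set
Formula n = List (Constraint n)

Assignment : ℕ → Set
Assignment n = Vec Bool n

_==_ : Bool → Bool → Bool
a == b = not (a xor b)

evalLiteral : ∀ {n} → Assignment n → Literal n → Bool
evalLiteral σ (s , v) = Vec.lookup σ v == s

evalConstraint : ∀ {n} → Assignment n → Constraint n → Bool
evalConstraint σ (clause C)    = any (evalLiteral σ) C
evalConstraint σ (parity vs b) = List.foldr (λ v a → Vec.lookup σ v xor a) false vs == b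

_⊨_ : ∀ {n} → Assignment n → Formula n → Set
σ ⊨ G = all (evalConstraint σ) G ≡ true

Satisfiable : ∀ {n} → Formula n → Set
Satisfiable G = ∃[ σ ] σ ⊨ G

_occursIn_ : ∀ {n} → Fin n → CNF n → Set
v occursIn F = Any (Any (λ l → proj₂ l ≡ v)) F

-- One symbol per literal occurrence and one per clause.
∣_∣ : ∀ {n} → CNF n → ℕ
∣ F ∣ = sum (List.map (suc ∘ List.length) F)

------------------------------------------------------------------------
-- Randomized programs with a SAT oracle, and their running time

-- Control structure, coin flips, oracle calls and ceilings of reals are
-- explicit; all other work is a pure term accounted for by 'charge'.
-- Conventions for the programs below: every call of a (recursive) function
-- charges at least one step and does a bounded number of constructor
-- applications, pattern matches and Boolean operations; library arithmetic is
-- charged at least the values of its arguments on ℕ (unary numbers) and at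
-- least their bit lengths on ℕᵇ; exact real arithmetic is charged one step
-- per operation.
data Prog : Set → Set₁ where
  return : ∀ {A} → A → Prog A
  _>>=_  : ∀ {A B} → Prog A → (A → Prog B) → Prog B
  charge : ℕ → Prog ⊤
  flip   : Prog Bool
  sat    : ∀ {n} → Formula n → Prog (Maybe (Assignment n))
  ceil   : ℝ≥0 → Prog ℕ
  -- iterate the body until it yields inj₂; termination is not guaranteed
  repeat : ∀ {S A} → (S → Prog (S ⊎ A)) → S → Prog A

infixl 1 _>>=_ _>>_

_>>_ : ∀ {A B} → Prog A → Prog B → Prog B
p >> q = p >>= λ _ → q

tick : Prog ⊤
tick = charge 1

Oracle : Set
Oracle = ∀ {n} (G : Formula n) → Dec (Satisfiable G)

answer : Oracle → ∀ {n} → Formula n → Maybe (Assignment n)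
answer O G = Maybe.map proj₁ (dec⇒maybe (O G))

-- An infinite sequence of random bits.
Tape : Set
Tape = ℕ → Bool

infix 4 _⊢_,_⇓_,_,_

-- O ⊢ p , ω ⇓ a , c , ω′: with oracle O and random bits ω, the program p halts
-- after c steps with result a, leaving the bits ω′ unread.  The ceiling k of a
-- real is found by comparing it with 0, 1, …, k.
data _⊢_,_⇓_,_,_ (O : Oracle) : ∀ {A} → Prog A → Tape → A → ℕ → Tape → Set₁ where
  return : ∀ {A} {a : A} {ω} → O ⊢ return a , ω ⇓ a , 0 , ω
  bind   : ∀ {A B} {p : Prog A} {f : A → Prog B} {ω ω′ ω″ a b c d} →
           O ⊢ p , ω ⇓ a , c , ω′ → O ⊢ f a , ω′ ⇓ b , d , ω″ →
           O ⊢ p >>= f , ω ⇓ b , c ℕ.+ d , ω″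
  charge : ∀ {k ω} → O ⊢ charge k , ω ⇓ tt , k , ω
  flip   : ∀ {ω} → O ⊢ flip , ω ⇓ ω 0 , 1 , ω ∘ suc
  sat    : ∀ {n} {G : Formula n} {ω} → O ⊢ sat G , ω ⇓ answer O G , 1 , ω
  ceil   : ∀ {x k ω} → IsCeiling x k → O ⊢ ceil x , ω ⇓ k , suc k , ω
  again  : ∀ {S A} {f : S → Prog (S ⊎ A)} {s s′ a ω ω′ ω″ c d} →
           O ⊢ f s , ω ⇓ inj₁ s′ , c , ω′ → O ⊢ repeat f s′ , ω′ ⇓ a , d , ω″ →
           O ⊢ repeat f s , ω ⇓ a , suc (c ℕ.+ d) , ω″
  stop   : ∀ {S A} {f : S → Prog (S ⊎ A)} {s a ω ω′ c} →
           O ⊢ f s , ω ⇓ inj₂ a , c , ω′ →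
           O ⊢ repeat f s , ω ⇓ a , suc c , ω′

-- Worst case over all oracles and all outcomes of the coin flips.
_runsInTime_ : ∀ {A} → Prog A → ℝ≥0 → Set₁
p runsInTime B = ∀ (O : Oracle) (ω : Tape) →
  ∃[ a ] ∃[ c ] ∃[ ω′ ] (O ⊢ p , ω ⇓ a , c , ω′) × c nat≤ B

------------------------------------------------------------------------
-- Auxiliary programs

length : {A : Set} → List A → Prog ℕ
length []       = tick >> return 0
length (x ∷ xs) = do
  tick
  k ← length xs
  return (suc k)

sucs : ∀ {n m} → Vec (Fin n) m → Prog (Vec (Fin (suc n)) m)
sucs []       = tick >> return []
sucs (v ∷ vs) = do
  tick
  ws ← sucs vs
  return (suc v ∷ ws)

-- The variables z₁, …, zₙ.
variables : ∀ n → Prog (Vec (Fin n) n)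
variables zero    = tick >> return []
variables (suc n) = do
  tick
  vs ← variables n
  ws ← sucs vs
  return (zero ∷ ws)

toFormula : ∀ {n} → CNF n → Prog (Formula n)
toFormula []      = tick >> return []
toFormula (C ∷ F) = do
  tick
  G ← toFormula F
  return (clause C ∷ G)

-- The clause satisfied by all assignments but the given one.
excluding : ∀ {n m} → Vec (Fin n) m → Vec Bool m → Prog (Clause n)
excluding []       []      = tick >> return []
excluding (z ∷ zs) (b ∷ σ) = do
  tick
  C ← excluding zs σ
  return ((not b , z) ∷ C)

boundedSAT : ∀ {n} → Vec (Fin n) n → Formula n → ℕ → Prog (List (Assignment n))
boundedSAT zs G zero    = tick >> return []
boundedSAT zs G (suc r) = do
  tick
  just σ ← sat G
    where nothing → return []
  C ← excluding zs σ
  S ← boundedSAT zs (clause C ∷ G) r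
  return (σ ∷ S)

randomBits : ∀ k → Prog (Vec Bool k)
randomBits zero    = tick >> return []
randomBits (suc k) = do
  tick
  b  ← flip
  bs ← randomBits k
  return (b ∷ bs)

-- The coefficients of a function h : {0,1}ⁿ → {0,1}ᵐ in H_xor(n,m,3); row i is
-- a_{i,0} ∷ a_{i,1} ∷ … ∷ a_{i,n} ∷ [].
Hash : ℕ → ℕ → Set
Hash n m = Vec (Vec Bool (suc n)) m

randomHash : ∀ n m → Prog (Hash n m)
randomHash n zero    = tick >> return []
randomHash n (suc m) = do
  tick
  a ← randomBits (suc n)
  h ← randomHash n m
  return (a ∷ h)

select : ∀ {n m} → Vec (Fin n) m → Vec Bool m → Prog (List (Fin n))
select []       []      = tick >> return []
select (z ∷ zs) (a ∷ as) = do
  tick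
  vs ← select zs as
  return (if a then z ∷ vs else vs)

-- G ∧ (h(z₁,…,zₙ) = α), where row i of the equation is the xor constraint
-- a_{i,1} z₁ ⊕ … ⊕ a_{i,n} zₙ = a_{i,0} ⊕ αᵢ.
conjoin : ∀ {n m} → Vec (Fin n) n → Formula n → Hash n m → Vec Bool m → Prog (Formula n)
conjoin zs G []             []      = tick >> return G
conjoin zs G ((a₀ ∷ as) ∷ h) (b ∷ α) = do
  tick
  vs ← select zs as
  G′ ← conjoin zs G h α
  return (parity vs (a₀ xor b) ∷ G′)

-- x · 2 ^ m
shift : ℕ → ℕᵇ → Prog ℕᵇ
shift zero    x = tick >> return x
shift (suc m) x = do
  charge (suc (ℕᵇ.size x))
  shift m (ℕᵇ.double x)

toBinary : ℕ → Prog ℕᵇ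
toBinary zero    = tick >> return ℕᵇ.zero
toBinary (suc k) = do
  tick
  x ← toBinary k
  charge (suc (ℕᵇ.size x))
  return (ℕᵇ.suc x)

insert : ℕᵇ → List ℕᵇ → Prog (List ℕᵇ)
insert x []       = tick >> return (x ∷ [])
insert x (y ∷ ys) = do
  charge (suc (ℕᵇ.size x ℕ.+ ℕᵇ.size y))
  if does (x ≤?ᵇ y)
    then return (x ∷ y ∷ ys)
    else (do
      zs ← insert x ys
      return (y ∷ zs))

sort : List ℕᵇ → Prog (List ℕᵇ)
sort []       = tick >> return []
sort (x ∷ xs) = do
  tick
  ys ← sort xs
  insert x ys

nth : ℕ → List ℕᵇ → Prog (Maybe ℕᵇ)
nth _       []       = tick >> return nothing
nth zero    (x ∷ xs) = tick >> return (just x)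
nth (suc k) (x ∷ xs) = tick >> nth k xs

-- The lower median of a nonempty list; nothing for the empty list.
median : List ℕᵇ → Prog (Maybe ℕᵇ)
median xs = do
  ys ← sort xs
  k  ← length ys
  charge (suc k)
  nth ⌊ k ∸ 1 /2⌋ ys

------------------------------------------------------------------------
-- ApproxMC; the result nothing stands for ⊥

-- The loop state is i; on exit the loop yields |S| and i.
approxMCCore : ∀ {n} → CNF n → ℕ → Prog (Maybe ℕᵇ)
approxMCCore {n} F pivot = do
  zs ← variables n
  G  ← toFormula F
  S  ← boundedSAT zs G (suc pivot)
  s  ← length S
  charge (suc (s ℕ.+ pivot))
  if s ≤ᵇ pivot
    then (do
      x ← toBinary s
      return (just x))
    else (do
      charge (suc pivot)
      -- pivot ≥ 40 when called from approxMC, so ∸ does not truncate here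
      let l = ⌊log₂ pivot ⌋ ∸ 1
      s , i ← repeat (body zs G l) (l ∸ 1)
      finish s i l)
  where
  inRange : ℕ → Bool
  inRange s = (1 ≤ᵇ s) ∧ (s ≤ᵇ pivot)

  body : Vec (Fin n) n → Formula n → ℕ → ℕ → Prog (ℕ ⊎ (ℕ × ℕ))
  body zs G l i₀ = do
    let i = suc i₀
    charge (suc (i ℕ.+ l))
    h ← randomHash n (i ∸ l)
    α ← randomBits (i ∸ l)
    H ← conjoin zs G h α
    S ← boundedSAT zs H (suc pivot)
    s ← length S
    charge (suc (s ℕ.+ pivot ℕ.+ i ℕ.+ n))
    return (if inRange s ∨ (i ≡ᵇ n) then inj₂ (s , i) else inj₁ i)

  finish : ℕ → ℕ → ℕ → Prog (Maybe ℕᵇ)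
  finish s i l = do
    charge (suc (s ℕ.+ pivot ℕ.+ i ℕ.+ l))
    if inRange s
      then (do
        x ← toBinary s
        y ← shift (i ∸ l) x
        return (just y))
      else return nothing

-- t independent runs of approxMCCore, without the failures.
collect : ∀ {n} → CNF n → ℕ → ℕ → Prog (List ℕᵇ)
collect F pivot zero    = tick >> return []
collect F pivot (suc t) = do
  tick
  r ← approxMCCore F pivot
  C ← collect F pivot t
  return (Maybe.maybe′ (_∷ C) C r)

-- pivot = 2 ⌈ halfPivot ε ⌉ with halfPivot ε = 3 e^{1/2} (1 + 1/ε)²
halfPivot : ℝ → ℝ≥0
halfPivot ε = nat 3 *ᵣ exp ½ *ᵣ (1+1/ε *ᵣ 1+1/ε)
  where
  1+1/ε : ℝ≥0
  1+1/ε = nat 1 +ᵣ recip ε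

-- t = ⌈ iterations δ ⌉ with iterations δ = 35 log₂ (3/δ)
iterations : ℝ → ℝ≥0
iterations δ = nat 35 *ᵣ log₂ (nat 3 *ᵣ recip δ)

approxMC : ∀ {n} → CNF n → ℝ → ℝ → Prog (Maybe ℕᵇ)
approxMC F ε δ = do
  charge 8
  k ← ceil (halfPivot ε)
  charge (suc (2 ℕ.* k))
  charge 4
  t ← ceil (iterations δ)
  C ← collect F (2 ℕ.* k) t
  median C

{-# OPTIONS --safe #-}

-- A run of ApproxMC costs a polynomial in the number t of iterations, the size
-- of F and the pivot, provided that every loop of ApproxMCCore stops, which it
-- does at the latest when i = n.  To get there i has to start below n: the
-- assignments found by BoundedSAT are distinct, so that pivot < 2 ^ n whenever
-- the loop is entered.  Moreover n ≤ |F| since every variable occurs in F, and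
--   t         ≤ 1 + 35 log₂ (3/δ)         ≤ 1 + 35 (2 + log₂ (1/δ)),
--   pivot / 2 ≤ 1 + 3 e^{1/2} (1 + 1/ε)²  ≤ 1 + 6 (1 + 1/ε)².

module Submission where

open import Defs
open import Data.Bool using (Bool; true; false; T; _∧_; _∨_; not; if_then_else_)
open import Data.Bool.ListAction using (any)
open import Data.Bool.Properties using (∧-conicalʳ)
open import Data.Empty using (⊥)
open import Data.Fin using (Fin; zero; suc)
import Data.Fin.Properties as Fin
open import Data.Integer as ℤ using (+_; +≤+)
import Data.Integer.Properties as ℤ
open import Data.List as List using (List; []; _∷_; _++_)
open import Data.List.Membership.Propositional using (_∈_)
open import Data.List.Membership.Propositional.Properties using (∈-map⁺; ∈-++⁺ˡ; ∈-++⁺ʳ; ∈-lookup)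
import Data.List.Properties as List
open import Data.List.Relation.Unary.All as All using (All; []; _∷_)
open import Data.List.Relation.Unary.AllPairs using ([]; _∷_)
open import Data.List.Relation.Unary.Any as Any using (Any; here; there)
open import Data.List.Relation.Unary.Any.Properties using (lookup-index)
open import Data.List.Relation.Unary.Unique.Propositional using (Unique)
open import Data.Maybe as Maybe using (just; nothing)
import Data.Maybe.Relation.Unary.All as Maybe
open import Data.Nat as ℕ using (ℕ; zero; suc; z≤n; s≤s; _+_; _*_; _∸_; _^_; _≤_; _<_; _≤ᵇ_; _≡ᵇ_)
open import Data.Nat.Binary as ℕᵇ using (ℕᵇ; 2[1+_]; 1+[2_])
open import Data.Nat.Binary.Properties using () renaming (_≤?_ to _≤?ᵇ_)
open import Data.Nat.Logarithm using (⌊log₂_⌋; ⌊log₂⌋-mono-≤; ⌊log₂[2^n]⌋≡n)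
import Data.Nat.Properties as ℕ
open import Data.Nat.Tactic.RingSolver using (solve-∀)
open import Data.Product using (∃; ∃-syntax; _×_; _,_; proj₂)
open import Data.Rational as ℚ using (ℚ; 0ℚ; 1ℚ; ½; *≤*)
import Data.Rational.Properties as ℚ
open import Data.Rational.Solver using (module +-*-Solver)
import Data.Rational.Unnormalised as ℚᵘ
import Data.Rational.Unnormalised.Properties as ℚᵘ
open import Data.Sum using (_⊎_; inj₁; inj₂; [_,_]′)
open import Data.Unit using (⊤; tt)
open import Data.Vec as Vec using (Vec; []; _∷_; lookup)
import Data.Vec.Properties as Vec
open import Relation.Binary.PropositionalEquality using (_≡_; _≢_; refl; sym; trans; cong; cong₂; subst; subst₂)
open import Relation.Nullary using (contradiction; yes; no; does)
open import Relation.Nullary.Decidable using (from-yes)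

-- Rational numbers

toℚᵘ-fromℕ : ∀ n → ℚ.toℚᵘ (fromℕ n) ℚᵘ.≃ ℚᵘ.mkℚᵘ (+ n) 0
toℚᵘ-fromℕ n = ℚ.toℚᵘ-fromℚᵘ (ℚᵘ.mkℚᵘ (+ n) 0)

fromℕ-+ : ∀ m n → fromℕ (m + n) ≡ fromℕ m ℚ.+ fromℕ n
fromℕ-+ m n = ℚ.toℚᵘ-injective (begin-equality
  ℚ.toℚᵘ (fromℕ (m + n))                    ≃⟨ toℚᵘ-fromℕ (m + n) ⟩
  ℚᵘ.mkℚᵘ (+ (m + n)) 0                     ≃⟨ ℚᵘ.*≡* (cong (λ k → + k ℤ.* + 1)
                                                 (sym (cong₂ ℕ._+_ (ℕ.*-identityʳ m) (ℕ.*-identityʳ n)))) ⟩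
  ℚᵘ.mkℚᵘ (+ (m * 1 + n * 1)) 0             ≃⟨ ℚᵘ.*≡* (cong (ℤ._* + 1)
                                                 (trans (ℤ.pos-+ (m * 1) (n * 1))
                                                   (cong₂ ℤ._+_ (ℤ.pos-* m 1) (ℤ.pos-* n 1)))) ⟩
  ℚᵘ.mkℚᵘ (+ m) 0 ℚᵘ.+ ℚᵘ.mkℚᵘ (+ n) 0      ≃⟨ ℚᵘ.+-cong (toℚᵘ-fromℕ m) (toℚᵘ-fromℕ n) ⟨
  ℚ.toℚᵘ (fromℕ m) ℚᵘ.+ ℚ.toℚᵘ (fromℕ n)    ≃⟨ ℚ.toℚᵘ-homo-+ (fromℕ m) (fromℕ n) ⟨
  ℚ.toℚᵘ (fromℕ m ℚ.+ fromℕ n)                ∎)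
  where open ℚᵘ.≤-Reasoning

fromℕ-* : ∀ m n → fromℕ (m * n) ≡ fromℕ m ℚ.* fromℕ n
fromℕ-* m n = ℚ.toℚᵘ-injective (begin-equality
  ℚ.toℚᵘ (fromℕ (m * n))                    ≃⟨ toℚᵘ-fromℕ (m * n) ⟩
  ℚᵘ.mkℚᵘ (+ (m * n)) 0                     ≃⟨ ℚᵘ.*≡* (cong (ℤ._* + 1) (ℤ.pos-* m n)) ⟩
  ℚᵘ.mkℚᵘ (+ m) 0 ℚᵘ.* ℚᵘ.mkℚᵘ (+ n) 0      ≃⟨ ℚᵘ.*-cong (toℚᵘ-fromℕ m) (toℚᵘ-fromℕ n) ⟨
  ℚ.toℚᵘ (fromℕ m) ℚᵘ.* ℚ.toℚᵘ (fromℕ n)    ≃⟨ ℚ.toℚᵘ-homo-* (fromℕ m) (fromℕ n) ⟨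
  ℚ.toℚᵘ (fromℕ m ℚ.* fromℕ n)                ∎)
  where open ℚᵘ.≤-Reasoning

fromℕ-mono-≤ : ∀ {m n} → m ≤ n → fromℕ m ℚ.≤ fromℕ n
fromℕ-mono-≤ {m} {n} m≤n = ℚ.toℚᵘ-cancel-≤ (begin
  ℚ.toℚᵘ (fromℕ m)  ≃⟨ toℚᵘ-fromℕ m ⟩
  ℚᵘ.mkℚᵘ (+ m) 0   ≤⟨ ℚᵘ.*≤* (subst₂ ℤ._≤_ (sym (ℤ.*-identityʳ (+ m))) (sym (ℤ.*-identityʳ (+ n))) (+≤+ m≤n)) ⟩
  ℚᵘ.mkℚᵘ (+ n) 0   ≃⟨ toℚᵘ-fromℕ n ⟨
  ℚ.toℚᵘ (fromℕ n)  ∎)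
  where open ℚᵘ.≤-Reasoning

0≤fromℕ : ∀ n → 0ℚ ℚ.≤ fromℕ n
0≤fromℕ n = fromℕ-mono-≤ {0} {n} z≤n

*-mono-≤ : ∀ {a b c d} → 0ℚ ℚ.≤ a → a ℚ.≤ b → 0ℚ ℚ.≤ c → c ℚ.≤ d → a ℚ.* c ℚ.≤ b ℚ.* d
*-mono-≤ {a} {b} {c} {d} 0≤a a≤b 0≤c c≤d = ℚ.≤-trans
  (ℚ.*-monoʳ-≤-nonNeg c {{ℚ.nonNegative 0≤c}} a≤b)
  (ℚ.*-monoˡ-≤-nonNeg b {{ℚ.nonNegative (ℚ.≤-trans 0≤a a≤b)}} c≤d)

0≤* : ∀ {a b} → 0ℚ ℚ.≤ a → 0ℚ ℚ.≤ b → 0ℚ ℚ.≤ a ℚ.* b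
0≤* {a} {b} 0≤a 0≤b = ℚ.nonNegative⁻¹ (a ℚ.* b)
  {{ℚ.nonNeg*nonNeg⇒nonNeg a {{ℚ.nonNegative 0≤a}} b {{ℚ.nonNegative 0≤b}}}}

-- Comparison of reals

infix 4 _⊑_

-- A real is represented by the rationals above it, so the smaller real has the larger set.
_⊑_ : ℝ≥0 → ℝ≥0 → Set
x ⊑ y = ∀ q → y q → x q

⊑-refl : ∀ {x} → x ⊑ x
⊑-refl q y = y

+ᵣ-mono : ∀ {x x′ y y′} → x ⊑ x′ → y ⊑ y′ → x +ᵣ y ⊑ x′ +ᵣ y′
+ᵣ-mono f g q (a , b , xa , yb , le) = a , b , f a xa , g b yb , le

*ᵣ-mono : ∀ {x x′ y y′} → x ⊑ x′ → y ⊑ y′ → x *ᵣ y ⊑ x′ *ᵣ y′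
*ᵣ-mono f g q (a , b , xa , yb , le) = a , b , f a xa , g b yb , le

-- k nat≤ x as a record, which lets Agda infer k and x.
infix 4 _≼_

record _≼_ (k : ℕ) (x : ℝ≥0) : Set where
  constructor lowerBound
  field below : k nat≤ x

open _≼_

≼-nat : ∀ k → k ≼ nat k
≼-nat k .below q = ℚ.<⇒≤

≼-mono : ∀ {k m x} → k ≤ m → m ≼ x → k ≼ x
≼-mono k≤m m≤x .below q xq = ℚ.≤-trans (fromℕ-mono-≤ k≤m) (m≤x .below q xq)

≼-+ : ∀ {k m x y} → k ≼ x → m ≼ y → k + m ≼ x +ᵣ y
≼-+ {k} {m} k≤x m≤y .below q (a , b , xa , yb , le) = ℚ.≤-trans
  (ℚ.≤-reflexive (fromℕ-+ k m)) (ℚ.≤-trans (ℚ.+-mono-≤ (k≤x .below a xa) (m≤y .below b yb)) le)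

≼-* : ∀ {k m x y} → k ≼ x → m ≼ y → k * m ≼ x *ᵣ y
≼-* {k} {m} k≤x m≤y .below q (a , b , xa , yb , le) = ℚ.≤-trans
  (ℚ.≤-reflexive (fromℕ-* k m))
  (ℚ.≤-trans (*-mono-≤ (0≤fromℕ k) (k≤x .below a xa) (0≤fromℕ m) (m≤y .below b yb)) le)

-- A negative `q` would give `1 ≤ a * q ≤ 0`.
0≤recip : ∀ x → 0 ≼ recip x
0≤recip x .below q (a , 0<a , _ , 1≤aq) with 0ℚ ℚ.≤? q
... | yes 0≤q = 0≤q
... | no  0≰q = contradiction (ℚ.≤-trans 1≤aq aq≤0) (λ { (*≤* (+≤+ ())) })
  where
  aq≤0 : a ℚ.* q ℚ.≤ 0ℚ
  aq≤0 = ℚ.≤-trans (ℚ.*-monoˡ-≤-nonNeg a {{ℚ.nonNegative (ℚ.<⇒≤ 0<a)}} (ℚ.<⇒≤ (ℚ.≰⇒> 0≰q)))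
    (ℚ.≤-reflexive (ℚ.*-zeroʳ a))

-- A negative `q` would make `q * (1 + b)` negative, yet it is at least the natural number `a`.
0≤log₂ : ∀ x → 0 ≼ log₂ x
0≤log₂ x .below q (r , a , b , _ , _ , a≤qb) with 0ℚ ℚ.≤? q
... | yes 0≤q = 0≤q
... | no  0≰q = contradiction (ℚ.≤-<-trans (ℚ.≤-trans (0≤fromℕ a) a≤qb) qb<0) (ℚ.<-irrefl refl)
  where
  qb<0 : q ℚ.* fromℕ (suc b) ℚ.< 0ℚ
  qb<0 = ℚ.<-≤-trans (ℚ.*-monoˡ-<-pos (fromℕ (suc b)) {{ℚ.normalize-pos (suc b) 1}} (ℚ.≰⇒> 0≰q))
    (ℚ.≤-reflexive (ℚ.*-zeroˡ (fromℕ (suc b))))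

-- Ceilings of reals

UpwardClosed : ℝ≥0 → Set
UpwardClosed x = ∀ {a b} → x a → a ℚ.≤ b → x b

-- The inequality `a * b ≤ q` in the definition of a product absorbs any increase of `q`.
*ᵣ-upwardClosed : ∀ x y → UpwardClosed (x *ᵣ y)
*ᵣ-upwardClosed x y (a , b , xa , yb , le) a≤b = a , b , xa , yb , ℚ.≤-trans le a≤b

-- If k = j + 1 were above 1 + y, then y < j for some approximation of y, and j
-- would already bound x.
ceiling-≤ : ∀ {x y k} → UpwardClosed x → x ⊑ y → 0 ≼ y → IsCeiling x k → k ≼ nat 1 +ᵣ y
ceiling-≤ {k = zero} up x⊑y 0≤y _ = ≼-mono z≤n (≼-+ (≼-nat 1) 0≤y)
ceiling-≤ {x} {y} {suc j} up x⊑y 0≤y (_ , least) .below q (a , b , 1<a , yb , a+b≤q) with fromℕ j ℚ.≤? b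
... | yes j≤b = ℚ.≤-trans (ℚ.≤-reflexive (fromℕ-+ 1 j))
                  (ℚ.≤-trans (ℚ.+-mono-≤ (ℚ.<⇒≤ 1<a) j≤b) a+b≤q)
... | no  j≰b = contradiction (least j x≤j) ℕ.1+n≰n
  where
  x≤j : x ≤nat j
  x≤j p j<p = up (x⊑y b yb) (ℚ.<⇒≤ (ℚ.<-trans (ℚ.≰⇒> j≰b) j<p))

-- Bounds on e^{1/2}

0≤expTerm½ : ∀ j → 0ℚ ℚ.≤ expTerm ½ j
0≤expTerm½ zero    = from-yes (0ℚ ℚ.≤? 1ℚ)
0≤expTerm½ (suc j) = 0≤* (0≤expTerm½ j)
  (0≤* (from-yes (0ℚ ℚ.≤? ½)) (ℚ.nonNegative⁻¹ (+ 1 ℚ./ suc j) {{ℚ.normalize-nonNeg 1 (suc j)}}))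

1/suc≤1 : ∀ j → + 1 ℚ./ suc j ℚ.≤ 1ℚ
1/suc≤1 j = ℚ.toℚᵘ-cancel-≤ (begin
  ℚ.toℚᵘ (+ 1 ℚ./ suc j)  ≃⟨ ℚ.toℚᵘ-fromℚᵘ (ℚᵘ.mkℚᵘ (+ 1) j) ⟩
  ℚᵘ.mkℚᵘ (+ 1) j         ≤⟨ ℚᵘ.*≤* (+≤+ (s≤s z≤n)) ⟩
  ℚ.toℚᵘ 1ℚ               ∎)
  where open ℚᵘ.≤-Reasoning

-- Consecutive terms have the ratio `½ / (j + 1)`.
expTerm½-halves : ∀ j → expTerm ½ (suc j) ℚ.≤ expTerm ½ j ℚ.* ½
expTerm½-halves j = ℚ.*-monoˡ-≤-nonNeg (expTerm ½ j) {{ℚ.nonNegative (0≤expTerm½ j)}}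
  (ℚ.*-monoˡ-≤-nonNeg ½ (1/suc≤1 j))

-- The terms of e^{1/2} at least halve, so adding twice the next term to a
-- partial sum gives a decreasing quantity, which starts at 2.
expSum½-bound : ∀ j → expSum ½ j ℚ.+ fromℕ 2 ℚ.* expTerm ½ j ℚ.≤ fromℕ 2
expSum½-bound zero    = from-yes (0ℚ ℚ.+ fromℕ 2 ℚ.* 1ℚ ℚ.≤? fromℕ 2)
expSum½-bound (suc j) = begin
  (s ℚ.+ u) ℚ.+ fromℕ 2 ℚ.* expTerm ½ (suc j)  ≤⟨ ℚ.+-monoʳ-≤ (s ℚ.+ u) (ℚ.*-monoˡ-≤-nonNeg (fromℕ 2) (expTerm½-halves j)) ⟩
  (s ℚ.+ u) ℚ.+ fromℕ 2 ℚ.* (u ℚ.* ½)          ≡⟨ solve 2 (λ s u → (s :+ u) :+ con (fromℕ 2) :* (u :* con ½)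
                                                               := s :+ con (fromℕ 2) :* u) refl s u ⟩
  s ℚ.+ fromℕ 2 ℚ.* u                          ≤⟨ expSum½-bound j ⟩
  fromℕ 2                                      ∎
  where
  open ℚ.≤-Reasoning
  open +-*-Solver
  s = expSum ½ j
  u = expTerm ½ j

-- Dropping the nonnegative second summand from `expSum½-bound` shows that 2 bounds every partial
-- sum.
exp½⊑2 : exp ½ ⊑ nat 2
exp½⊑2 q 2<q = fromℕ 2 , 2<q , λ j → begin
  expSum ½ j                                 ≡⟨ ℚ.+-identityʳ (expSum ½ j) ⟨
  expSum ½ j ℚ.+ 0ℚ                          ≤⟨ ℚ.+-monoʳ-≤ (expSum ½ j)
                                                  (ℚ.*-monoˡ-≤-nonNeg (fromℕ 2) (0≤expTerm½ j)) ⟩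
  expSum ½ j ℚ.+ fromℕ 2 ℚ.* expTerm ½ j     ≤⟨ expSum½-bound j ⟩
  fromℕ 2                                    ∎
  where open ℚ.≤-Reasoning

-- The partial sum with a single term is already 1.
1≤exp½ : 1 ≼ exp ½
1≤exp½ .below q (r , r<q , sums≤r) = ℚ.≤-trans (sums≤r 1) (ℚ.<⇒≤ r<q)

-- Powers and the binary logarithm

0≤^ℚ : ∀ {q} → 0ℚ ℚ.≤ q → ∀ n → 0ℚ ℚ.≤ q ^ℚ n
0≤^ℚ 0≤q zero    = from-yes (0ℚ ℚ.≤? 1ℚ)
0≤^ℚ 0≤q (suc n) = 0≤* 0≤q (0≤^ℚ 0≤q n)

^ℚ-distrib-* : ∀ p q n → (p ℚ.* q) ^ℚ n ≡ (p ^ℚ n) ℚ.* (q ^ℚ n)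
^ℚ-distrib-* p q zero    = refl
^ℚ-distrib-* p q (suc n) = trans (cong ((p ℚ.* q) ℚ.*_) (^ℚ-distrib-* p q n))
  (solve 4 (λ p q a b → (p :* q) :* (a :* b) := (p :* a) :* (q :* b)) refl p q (p ^ℚ n) (q ^ℚ n))
  where open +-*-Solver

fromℕ-^ : ∀ m n → fromℕ (m ^ n) ≡ fromℕ m ^ℚ n
fromℕ-^ m zero    = refl
fromℕ-^ m (suc n) = trans (fromℕ-* m (m ^ n)) (cong (fromℕ m ℚ.*_) (fromℕ-^ m n))

-- Since `3 < 4`, the logarithm of 3x is at most that of 4x, which is 2 + log₂ x.
log₂[3x]⊑2+log₂x : ∀ {x} → 0 ≼ x → log₂ (nat 3 *ᵣ x) ⊑ nat 2 +ᵣ log₂ x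
log₂[3x]⊑2+log₂x 0≤x q (c , d , 2<c , (r , a , b , xr , rⁿ≤2ᵃ , a≤dn) , c+d≤q) =
  -- Passing from `r` to `4 * r` multiplies the `n`-th power by `2 ^ (2 * n)`, so the fraction
  -- `a / n` grows by exactly 2.
  fromℕ 4 ℚ.* r , 2 * n + a , b ,
  (fromℕ 4 , r , from-yes (fromℕ 3 ℚ.<? fromℕ 4) , xr , ℚ.≤-refl) , power , exponent
  where
  open ℚ.≤-Reasoning
  n = suc b
  power : (fromℕ 4 ℚ.* r) ^ℚ n ℚ.≤ fromℕ (2 ^ (2 * n + a))
  power = begin
    (fromℕ 4 ℚ.* r) ^ℚ n                    ≡⟨ ^ℚ-distrib-* (fromℕ 4) r n ⟩
    (fromℕ 4 ^ℚ n) ℚ.* (r ^ℚ n)             ≤⟨ *-mono-≤ (0≤^ℚ (0≤fromℕ 4) n) ℚ.≤-refl (0≤^ℚ (0≤x .below r xr) n) rⁿ≤2ᵃ ⟩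
    (fromℕ 4 ^ℚ n) ℚ.* fromℕ (2 ^ a)      ≡⟨ cong (ℚ._* fromℕ (2 ^ a)) (fromℕ-^ 4 n) ⟨
    fromℕ (4 ^ n) ℚ.* fromℕ (2 ^ a)     ≡⟨ fromℕ-* (4 ^ n) (2 ^ a) ⟨
    fromℕ (4 ^ n * 2 ^ a)             ≡⟨ cong (λ e → fromℕ (e * 2 ^ a)) (ℕ.^-*-assoc 2 2 n) ⟩
    fromℕ (2 ^ (2 * n) * 2 ^ a)     ≡⟨ cong fromℕ (ℕ.^-distribˡ-+-* 2 (2 * n) a) ⟨
    fromℕ (2 ^ (2 * n + a))           ∎
  exponent : fromℕ (2 * n + a) ℚ.≤ q ℚ.* fromℕ n
  exponent = begin
    fromℕ (2 * n + a)                   ≡⟨ fromℕ-+ (2 * n) a ⟩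
    fromℕ (2 * n) ℚ.+ fromℕ a             ≡⟨ cong (ℚ._+ fromℕ a) (fromℕ-* 2 n) ⟩
    fromℕ 2 ℚ.* fromℕ n ℚ.+ fromℕ a         ≤⟨ ℚ.+-mono-≤ (*-mono-≤ (0≤fromℕ 2) (ℚ.<⇒≤ 2<c) (0≤fromℕ n) ℚ.≤-refl) a≤dn ⟩
    c ℚ.* fromℕ n ℚ.+ d ℚ.* fromℕ n         ≡⟨ ℚ.*-distribʳ-+ (fromℕ n) c d ⟨
    (c ℚ.+ d) ℚ.* fromℕ n                   ≤⟨ ℚ.*-monoʳ-≤-nonNeg (fromℕ n) {{ℚ.nonNegative (0≤fromℕ n)}} c+d≤q ⟩
    q ℚ.* fromℕ n                           ∎

-- Polynomials

evalℕ : ∀ {k} → Polynomial k → Vec ℕ k → ℕ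
evalℕ (con c) v = c
evalℕ (var i) v = lookup v i
evalℕ (p ⊕ q) v = evalℕ p v + evalℕ q v
evalℕ (p ⊗ q) v = evalℕ p v * evalℕ q v

substitute : ∀ {k l} → Polynomial k → Vec (Polynomial l) k → Polynomial l
substitute (con c) ps = con c
substitute (var i) ps = lookup ps i
substitute (p ⊕ q) ps = substitute p ps ⊕ substitute q ps
substitute (p ⊗ q) ps = substitute p ps ⊗ substitute q ps

-- With natural coefficients a polynomial is monotone in its arguments. This turns a cost bound in
-- natural numbers into one in the real parameters.
evalℕ-≤-eval : ∀ {k l} (p : Polynomial k) (v : Vec ℕ k) (ps : Vec (Polynomial l) k) (ρ : Vec ℝ≥0 l) →
  (∀ i → lookup v i ≼ eval (lookup ps i) ρ) → evalℕ p v ≼ eval (substitute p ps) ρ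
evalℕ-≤-eval (con c) v ps ρ v≤ = ≼-nat c
evalℕ-≤-eval (var i) v ps ρ v≤ = v≤ i
evalℕ-≤-eval (p ⊕ q) v ps ρ v≤ = ≼-+ (evalℕ-≤-eval p v ps ρ v≤) (evalℕ-≤-eval q v ps ρ v≤)
evalℕ-≤-eval (p ⊗ q) v ps ρ v≤ = ≼-* (evalℕ-≤-eval p v ps ρ v≤) (evalℕ-≤-eval q v ps ρ v≤)

-- The number of iterations and the pivot

iterations-≤ : ∀ δ {t} → IsCeiling (iterations δ) t →
  t ≼ nat 1 +ᵣ nat 35 *ᵣ (nat 2 +ᵣ log₂ (recip δ))
iterations-≤ δ = ceiling-≤ (*ᵣ-upwardClosed (nat 35) (log₂ (nat 3 *ᵣ recip δ)))
  (*ᵣ-mono {nat 35} ⊑-refl (log₂[3x]⊑2+log₂x (0≤recip δ)))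
  (≼-mono z≤n (≼-* (≼-nat 35) (≼-+ (≼-nat 2) (0≤log₂ (recip δ)))))

1≤1+1/ε : ∀ ε → 1 ≼ nat 1 +ᵣ recip ε
1≤1+1/ε ε = ≼-+ (≼-nat 1) (0≤recip ε)

-- Polynomials have natural coefficients, so the factor e^{1/2} is replaced by 2.
halfPivot-≤ : ∀ ε {k} → IsCeiling (halfPivot ε) k →
  k ≼ nat 1 +ᵣ nat 3 *ᵣ nat 2 *ᵣ ((nat 1 +ᵣ recip ε) *ᵣ (nat 1 +ᵣ recip ε))
halfPivot-≤ ε = ceiling-≤ (*ᵣ-upwardClosed (nat 3 *ᵣ exp ½) (u *ᵣ u))
  (*ᵣ-mono {_} {_} {u *ᵣ u} (*ᵣ-mono {nat 3} ⊑-refl exp½⊑2) ⊑-refl)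
  (≼-mono z≤n (≼-* (≼-* (≼-nat 3) (≼-nat 2)) (≼-* (1≤1+1/ε ε) (1≤1+1/ε ε))))
  where u = nat 1 +ᵣ recip ε

-- A positive pivot is what excludes `n = 0` when the loop is entered. If the ceiling were 0, then
-- `½` would lie above a real that is at least 3.
ceil-halfPivot-positive : ∀ ε {k} → IsCeiling (halfPivot ε) k → 1 ≤ k
ceil-halfPivot-positive ε {zero}  (x≤0 , _) = contradiction
  (≼-mono {1} (s≤s z≤n) 3≤x .below ½ (x≤0 ½ (from-yes (0ℚ ℚ.<? ½)))) (λ { (*≤* (+≤+ (s≤s ()))) })
  where
  3≤x : 3 ≼ halfPivot ε
  3≤x = ≼-* (≼-* (≼-nat 3) 1≤exp½) (≼-* (1≤1+1/ε ε) (1≤1+1/ε ε))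
ceil-halfPivot-positive ε {suc k} _         = s≤s z≤n

-- Counting

lookup-injective : ∀ {A : Set} {xs : List A} → Unique xs →
  ∀ i j → List.lookup xs i ≡ List.lookup xs j → i ≡ j
lookup-injective (x≢ ∷ u) zero    zero    eq = refl
lookup-injective (x≢ ∷ u) zero    (suc j) eq = contradiction eq (All.lookup x≢ (∈-lookup j))
lookup-injective (x≢ ∷ u) (suc i) zero    eq = contradiction (sym eq) (All.lookup x≢ (∈-lookup i))
lookup-injective (x≢ ∷ u) (suc i) (suc j) eq = cong suc (lookup-injective u i j eq)

-- Sending each index of `xs` to a place of the same element in `ys` is injective, because `xs` has
-- no repetitions.
unique-length-≤ : ∀ {A : Set} {xs ys : List A} → Unique xs → (∀ {x} → x ∈ xs → x ∈ ys) →
  List.length xs ≤ List.length ys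
unique-length-≤ {xs = xs} {ys} u sub = Fin.injective⇒≤ {f = position} λ {i} {j} eq →
  lookup-injective u i j (trans (lookup-index (sub (∈-lookup i)))
    (trans (cong (List.lookup ys) eq) (sym (lookup-index (sub (∈-lookup j))))))
  where
  position : Fin (List.length xs) → Fin (List.length ys)
  position i = Any.index (sub (∈-lookup i))

assignments : ∀ n → List (Assignment n)
assignments zero    = [] ∷ []
assignments (suc n) = List.map (false ∷_) (assignments n) ++ List.map (true ∷_) (assignments n)

∈-assignments : ∀ {n} (σ : Assignment n) → σ ∈ assignments n
∈-assignments []          = here refl
∈-assignments (false ∷ σ) = ∈-++⁺ˡ (∈-map⁺ (false ∷_) (∈-assignments σ))
∈-assignments (true ∷ σ)  = ∈-++⁺ʳ (List.map (false ∷_) (assignments _)) (∈-map⁺ (true ∷_) (∈-assignments σ))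

length-assignments : ∀ n → List.length (assignments n) ≡ 2 ^ n
length-assignments zero    = refl
length-assignments (suc n) = trans (List.length-++ (List.map (false ∷_) (assignments n)))
  (cong₂ _+_ (trans (List.length-map _ (assignments n)) (length-assignments n))
    (trans (List.length-map _ (assignments n)) (trans (length-assignments n) (sym (ℕ.+-identityʳ (2 ^ n))))))

unique-assignments-≤ : ∀ {n} {S : List (Assignment n)} → Unique S → List.length S ≤ 2 ^ n
unique-assignments-≤ {n} u = ℕ.≤-trans (unique-length-≤ u (λ {σ} _ → ∈-assignments σ))
  (ℕ.≤-reflexive (length-assignments n))

occurrences : ∀ {n} → CNF n → List (Fin n)
occurrences = List.concatMap (List.map proj₂)

length-occurrences : ∀ {n} (F : CNF n) → List.length (occurrences F) ≤ ∣ F ∣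
length-occurrences []      = z≤n
length-occurrences (C ∷ F) = subst (_≤ ∣ C ∷ F ∣) (sym (List.length-++ (List.map proj₂ C)))
  (ℕ.+-mono-≤ (ℕ.≤-trans (ℕ.≤-reflexive (List.length-map proj₂ C)) (ℕ.n≤1+n _)) (length-occurrences F))

∈-occurrences : ∀ {n} {v : Fin n} (F : CNF n) → v occursIn F → v ∈ occurrences F
∈-occurrences (C ∷ F) (here v∈C)  = ∈-++⁺ˡ (literal C v∈C)
  where
  literal : ∀ C → Any (λ l → proj₂ l ≡ _) C → _ ∈ List.map proj₂ C
  literal (l ∷ C) (here eq)   = here (sym eq)
  literal (l ∷ C) (there v∈C) = there (literal C v∈C)
∈-occurrences (C ∷ F) (there v∈F) = ∈-++⁺ʳ (List.map proj₂ C) (∈-occurrences F v∈F)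

-- Choosing one occurrence for each variable embeds the variables into the literal occurrences.
variables-≤-size : ∀ {n} (F : CNF n) → (∀ v → v occursIn F) → n ≤ ∣ F ∣
variables-≤-size {n} F occurs = ℕ.≤-trans (Fin.injective⇒≤ {f = position} injective) (length-occurrences F)
  where
  position : Fin n → Fin (List.length (occurrences F))
  position v = Any.index (∈-occurrences F (occurs v))
  injective : ∀ {v w} → position v ≡ position w → v ≡ w
  injective {v} {w} eq = trans (lookup-index (∈-occurrences F (occurs v)))
    (trans (cong (List.lookup (occurrences F)) eq) (sym (lookup-index (∈-occurrences F (occurs w)))))

length-≤-size : ∀ {n} (F : CNF n) → List.length F ≤ ∣ F ∣
length-≤-size []      = z≤n
length-≤-size (C ∷ F) = s≤s (ℕ.≤-trans (length-≤-size F) (ℕ.m≤n+m _ (List.length C)))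

-- Binary numbers

-- The digits are 1 and 2; only a 2 passes on a carry, which may add one digit at the end.
size-suc : ∀ x → ℕᵇ.size (ℕᵇ.suc x) ≤ suc (ℕᵇ.size x)
size-suc ℕᵇ.zero  = ℕ.≤-refl
size-suc 2[1+ x ] = s≤s (size-suc x)
size-suc 1+[2 x ] = ℕ.n≤1+n _

size-double : ∀ x → ℕᵇ.size (ℕᵇ.double x) ≤ suc (ℕᵇ.size x)
size-double ℕᵇ.zero  = z≤n
size-double 2[1+ x ] = ℕ.≤-refl
size-double 1+[2 x ] = s≤s (size-double x)

-- Arithmetic of the cost recursions

square-step : ∀ n → 1 + ((1 + n) * (1 + n) + (1 + n)) + (1 + n) ≡ (2 + n) * (2 + n)
square-step = solve-∀

boundedSAT-step : ∀ n r → 2 + ((1 + n) + (1 + r * (3 + n))) ≡ 1 + (1 + r) * (3 + n)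
boundedSAT-step = solve-∀

randomHash-step : ∀ n m → 1 + ((1 + (1 + n) * 2) + (1 + m * (4 + n * 2))) ≡ 1 + (1 + m) * (4 + n * 2)
randomHash-step = solve-∀

conjoin-step : ∀ n m → 1 + ((1 + n) + (1 + m * (2 + n))) ≡ 1 + (1 + m) * (2 + n)
conjoin-step = solve-∀

toBinary-step : ∀ k s → 1 + ((1 + k * (2 + s)) + ((1 + s) + 0)) ≡ 1 + (1 + k) * (2 + s)
toBinary-step = solve-∀

sort-step : ∀ k c → 1 + ((1 + k * (1 + c)) + c) ≡ 1 + (1 + k) * (1 + c)
sort-step = solve-∀

-- Tests and the range of the loop index

>ᵇ⇒> : ∀ {m n} → (m ≤ᵇ n) ≡ false → n < m
>ᵇ⇒> m≰ᵇn = ℕ.≰⇒> λ m≤n → subst T m≰ᵇn (ℕ.≤⇒≤ᵇ m≤n)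

≢ᵇ⇒≢ : ∀ {m n} → (m ≡ᵇ n) ≡ false → m ≢ n
≢ᵇ⇒≢ m≢ᵇn m≡n = subst T m≢ᵇn (ℕ.≡⇒≡ᵇ _ _ m≡n)

⌊log₂⌋-≤ : ∀ {m n} → m ≤ 2 ^ n → ⌊log₂ m ⌋ ≤ n
⌊log₂⌋-≤ {n = n} m≤2ⁿ = ℕ.≤-trans (⌊log₂⌋-mono-≤ m≤2ⁿ) (ℕ.≤-reflexive (⌊log₂[2^n]⌋≡n n))

-- Whatever the random outcome `c`, the loop goes on only if `i` differs from `n`, which restores
-- the invariant `i < n`.
loop-exit : ∀ {A : Set} {Q : A → Set} c {i n a} → i ≤ n → Q a →
  [ (λ j → j ≡ i × j < n) , Q ]′ (if c ∨ (i ≡ᵇ n) then inj₂ a else inj₁ i)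
loop-exit true             i≤n Qa = Qa
loop-exit false {i} {n} i≤n Qa with i ≡ᵇ n in eq
... | true  = Qa
... | false = refl , ℕ.≤∧≢⇒< i≤n (≢ᵇ⇒≢ eq)

-- Truncated subtraction makes this fail only at `n = 0`, where no `m` satisfies `1 ≤ m < 1`.
n∸1<n : ∀ {m n} → 1 ≤ m → m < 2 ^ n → n ∸ 1 < n
n∸1<n {n = zero}  1≤m m<1 = contradiction (ℕ.≤-<-trans 1≤m m<1) (ℕ.<-irrefl refl)
n∸1<n {n = suc n} _   _   = ℕ.n<1+n n

-- Time bounds, whose summands are the costs of the successive steps of the
-- programs.  N bounds both the number of variables and the size of the formula,
-- P is the pivot, K is half of it and T is the number of iterations.

open Defs using () renaming (_⊕_ to infixr 6 _⊞_; _⊗_ to infixr 7 _⊠_)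

module _ {k : ℕ} where

  infix 8 1+_ 2+_

  1+_ 2+_ : Polynomial k → Polynomial k
  1+ p = con 1 ⊞ p
  2+ p = con 2 ⊞ p

  boundedSATCost trialCost coreCost : Polynomial k → Polynomial k → Polynomial k
  boundedSATCost N P = 1+ (1+ P ⊠ (con 3 ⊞ N))
  trialCost N P =
    1+ (N ⊞ N) ⊞ 1+ (N ⊠ (con 4 ⊞ N ⊠ con 2)) ⊞ 1+ (N ⊠ con 2) ⊞ 1+ (N ⊠ 2+ N) ⊞
    boundedSATCost N P ⊞ 2+ P ⊞ 1+ (((1+ P ⊞ P) ⊞ N) ⊞ N)
  coreCost N P =
    1+ N ⊠ 1+ N ⊞ 1+ N ⊞ boundedSATCost N P ⊞ 2+ P ⊞ 1+ (1+ P ⊞ P) ⊞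
    1+ (1+ P ⊠ (con 3 ⊞ P)) ⊞
    1+ P ⊞ N ⊠ 1+ (trialCost N P) ⊞ 1+ (((1+ P ⊞ P) ⊞ N) ⊞ N) ⊞
    -- Both branches of a conditional are counted; `con 0` is the branch that returns ⊥.
    (1+ (1+ P ⊠ (con 3 ⊞ P)) ⊞ 1+ (N ⊠ 1+ (1+ P ⊞ N))) ⊞ con 0

  collectCost totalCost : Polynomial k → Polynomial k → Polynomial k → Polynomial k
  collectCost T N P = 1+ (T ⊠ 1+ (coreCost N P))
  totalCost T N K =
    con 8 ⊞ 1+ K ⊞ 1+ (con 2 ⊠ K) ⊞ con 4 ⊞ 1+ T ⊞ collectCost T N (con 2 ⊠ K) ⊞
    -- A list entry has at most `1 + P` digits from the count and `N` more from the shift.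
    medianCost T (1+ (con 2 ⊠ K) ⊞ N)
    where
    medianCost : Polynomial k → Polynomial k → Polynomial k
    medianCost L S = 1+ (L ⊠ 1+ (L ⊠ 1+ (S ⊞ S))) ⊞ 1+ L ⊞ 1+ L ⊞ 1+ L

-- A cost calculus for programs

module Cost (O : Oracle) where

  -- A total-correctness triple: it includes halting on every tape. The postcondition is there
  -- because later costs depend on earlier results.
  record Runs {A : Set} (p : Prog A) (P : A → Set) (b : ℕ) : Set₁ where
    constructor mkRuns
    field halts : ∀ ω → ∃[ a ] ∃[ c ] ∃[ ω′ ] (O ⊢ p , ω ⇓ a , c , ω′) × P a × c ≤ b

  open Runs public

  private variable
    A B : Set
    p : Prog A
    P Q : A → Set
    b d k : ℕ

  weaken : Runs p P b → b ≤ d → Runs p P d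
  weaken r b≤d .halts ω with a , c , ω′ , run , Pa , c≤b ← r .halts ω =
    a , c , ω′ , run , Pa , ℕ.≤-trans c≤b b≤d

  runs-consequence : Runs p P b → (∀ {a} → P a → Q a) → Runs p Q b
  runs-consequence r P⇒Q .halts ω with a , c , ω′ , run , Pa , c≤b ← r .halts ω =
    a , c , ω′ , run , P⇒Q Pa , c≤b

  runs-return : ∀ {a} → P a → Runs (return a) P 0
  runs-return Pa .halts ω = _ , 0 , ω , return , Pa , z≤n

  runs-bind : {f : A → Prog B} → Runs p P b → (∀ a → P a → Runs (f a) Q d) → Runs (p >>= f) Q (b + d)
  runs-bind r s .halts ω with a , c , ω′ , run , Pa , c≤b ← r .halts ω
    with a′ , c′ , ω″ , run′ , Qa′ , c′≤d ← s a Pa .halts ω′ =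
    a′ , c + c′ , ω″ , bind run run′ , Qa′ , ℕ.+-mono-≤ c≤b c′≤d

  runs-map : {g : A → B} → Runs p P b → (∀ a → P a → Q (g a)) → Runs (p >>= λ a → return (g a)) Q b
  runs-map r Pa⇒Qga = weaken (runs-bind r (λ a Pa → runs-return (Pa⇒Qga a Pa))) (ℕ.≤-reflexive (ℕ.+-identityʳ _))

  runs-charge : k ≤ d → Runs p P b → Runs (charge k >> p) P (d + b)
  runs-charge k≤d r = runs-bind {P = λ _ → ⊤} (mkRuns λ ω → tt , _ , ω , charge , tt , k≤d) (λ _ _ → r)

  runs-tick : Runs p P b → Runs (tick >> p) P (suc b)
  runs-tick = runs-charge ℕ.≤-refl

  runs-flip : Runs flip (λ _ → ⊤) 1
  runs-flip .halts ω = _ , _ , _ , flip , tt , ℕ.≤-refl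

  runs-sat : ∀ {n} (G : Formula n) → Runs (sat G) (Maybe.All (_⊨ G)) 1
  runs-sat G .halts ω = _ , _ , _ , sat , correct , ℕ.≤-refl
    where
    correct : Maybe.All (_⊨ G) (answer O G)
    correct with O G
    ... | yes (σ , σ⊨G) = Maybe.just σ⊨G
    ... | no  _         = Maybe.nothing

  runs-ceil : ∀ {x} → IsCeiling x k → Runs (ceil x) (_≡ k) (suc k)
  runs-ceil h .halts ω = _ , _ , ω , ceil h , refl , ℕ.≤-refl

  -- Adding the two costs instead of taking their maximum keeps the bounds polynomial.
  runs-if : ∀ c {q : Prog A} → Runs p P b → (c ≡ false → Runs q P d) → Runs (if c then p else q) P (b + d)
  runs-if true  r s = weaken r (ℕ.m≤m+n _ _)
  runs-if false r s = weaken (s refl) (ℕ.m≤n+m _ _)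

  -- The number `m` bounds the rounds left. Each round that goes on raises `i` by one and keeps it
  -- below `n`, so `m` cannot reach 0 before the loop stops.
  runs-repeat : ∀ {f : ℕ → Prog (ℕ ⊎ A)} {n} →
    (∀ i → i < n → Runs (f i) [ (λ j → j ≡ suc i × j < n) , Q ]′ b) →
    ∀ m i → i < n → n ≤ i + m → Runs (repeat f i) Q (m * suc b)
  runs-repeat step zero    i i<n n≤i =
    contradiction (ℕ.<-≤-trans i<n (ℕ.≤-trans n≤i (ℕ.≤-reflexive (ℕ.+-identityʳ i)))) (ℕ.<-irrefl refl)
  runs-repeat {b = b} step (suc m) i i<n n≤i+m .halts ω with step i i<n .halts ω
  ... | inj₂ a , c , ω′ , run , Qa , c≤b =
    a , suc c , ω′ , stop run , Qa , s≤s (ℕ.≤-trans c≤b (ℕ.m≤m+n b (m * suc b)))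
  ... | inj₁ _ , c , ω′ , run , (refl , 1+i<n) , c≤b
    with a , c′ , ω″ , run′ , Qa , c′≤ ←
           runs-repeat step m (suc i) 1+i<n (ℕ.≤-trans n≤i+m (ℕ.≤-reflexive (ℕ.+-suc i m))) .halts ω′ =
    a , suc (c + c′) , ω″ , again run run′ , Qa , s≤s (ℕ.+-mono-≤ c≤b c′≤)

  -- Costs of the auxiliary programs

  runs-length : {A : Set} (xs : List A) → Runs (length xs) (_≡ List.length xs) (suc (List.length xs))
  runs-length []       = runs-tick (runs-return refl)
  runs-length (x ∷ xs) = runs-tick (runs-map (runs-length xs) (λ _ → cong suc))

  runs-sucs : ∀ {n m} (vs : Vec (Fin n) m) → Runs (sucs vs) (_≡ Vec.map suc vs) (suc m)
  runs-sucs []       = runs-tick (runs-return refl)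
  runs-sucs (v ∷ vs) = runs-tick (runs-map (runs-sucs vs) (λ _ → cong (suc v ∷_)))

  runs-variables : ∀ n → Runs (variables n) (λ vs → ∀ i → Vec.lookup vs i ≡ i) (suc n * suc n)
  runs-variables zero    = runs-tick (runs-return λ ())
  runs-variables (suc n) = weaken
    (runs-tick (runs-bind (runs-variables n) λ vs vs≡ → runs-map (runs-sucs vs) λ { _ refl → λ
      { zero → refl ; (suc i) → trans (Vec.lookup-map i suc vs) (cong suc (vs≡ i)) } }))
    -- Another `1 + n` steps are added as slack, to complete the square.
    (ℕ.≤-trans (ℕ.m≤m+n _ (suc n)) (ℕ.≤-reflexive (square-step n)))

  runs-toFormula : ∀ {n} (F : CNF n) → Runs (toFormula F) (λ _ → ⊤) (suc (List.length F))
  runs-toFormula []      = runs-tick (runs-return tt)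
  runs-toFormula (C ∷ F) = runs-tick (runs-map (runs-toFormula F) _)

  -- The literal `(not b , z)` is false wherever `z` has the value `b`, so an assignment that agrees
  -- with `τ` along `zs` falsifies every literal.
  runs-excluding : ∀ {n m} (zs : Vec (Fin n) m) (τ : Vec Bool m) → Runs (excluding zs τ)
    (λ C → ∀ σ → (∀ i → Vec.lookup σ (Vec.lookup zs i) ≡ Vec.lookup τ i) → any (evalLiteral σ) C ≡ false)
    (suc m)
  runs-excluding []       []      = runs-tick (runs-return λ _ _ → refl)
  runs-excluding (z ∷ zs) (b ∷ τ) = runs-tick (runs-map (runs-excluding zs τ) λ C falseC σ agree →
    cong₂ _∨_ (trans (cong (_== not b) (agree zero)) (b==not-b b)) (falseC σ (λ i → agree (suc i))))
    where
    b==not-b : ∀ b → (b == not b) ≡ false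
    b==not-b true  = refl
    b==not-b false = refl

  -- Soundness is carried along to get distinctness: the later assignments satisfy the clause `C`,
  -- which `σ` falsifies. A round costs one tick, one oracle call and `1 + n` steps for `C`.
  runs-boundedSAT : ∀ {n} (zs : Vec (Fin n) n) → (∀ i → Vec.lookup zs i ≡ i) → ∀ G r →
    Runs (boundedSAT zs G r) (λ S → List.length S ≤ r × Unique S × All (_⊨ G) S) (suc (r * (3 + n)))
  runs-boundedSAT zs zs≡ G zero    = runs-tick (runs-return (z≤n , [] , []))
  runs-boundedSAT {n} zs zs≡ G (suc r) = weaken
    (runs-tick (runs-bind (runs-sat G) λ
      { nothing  _                → weaken (runs-return (z≤n , [] , [])) z≤n
      ; (just σ) (Maybe.just σ⊨G) →
        runs-bind (runs-excluding zs σ) λ C falseC →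
        runs-map (runs-boundedSAT zs zs≡ (clause C ∷ G) r) λ S (length≤ , unique , sound) →
          s≤s length≤ ,
          All.map (λ {τ} τ⊨ σ≡τ → excluded C G (falseC σ (λ i → cong (Vec.lookup σ) (zs≡ i)))
                                      (subst (_⊨ (clause C ∷ G)) (sym σ≡τ) τ⊨)) sound ∷ unique ,
          σ⊨G ∷ All.map (λ {τ} → ∧-conicalʳ (any (evalLiteral τ) C) _) sound }))
    (ℕ.≤-reflexive (boundedSAT-step n r))
    where
    excluded : ∀ C G {σ} → any (evalLiteral σ) C ≡ false → σ ⊨ (clause C ∷ G) → ⊥
    excluded C G {σ} eq σ⊨ with any (evalLiteral σ) C
    excluded C G refl () | false

  runs-randomBits : ∀ k → Runs (randomBits k) (λ _ → ⊤) (suc (k * 2))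
  runs-randomBits zero    = runs-tick (runs-return tt)
  runs-randomBits (suc k) = runs-tick (runs-bind runs-flip λ _ _ → runs-map (runs-randomBits k) _)

  runs-randomHash : ∀ n m → Runs (randomHash n m) (λ _ → ⊤) (suc (m * (4 + n * 2)))
  runs-randomHash n zero    = runs-tick (runs-return tt)
  runs-randomHash n (suc m) = weaken
    (runs-tick (runs-bind (runs-randomBits (suc n)) λ _ _ → runs-map (runs-randomHash n m) _))
    (ℕ.≤-reflexive (randomHash-step n m))

  runs-select : ∀ {n m} (zs : Vec (Fin n) m) as → Runs (select zs as) (λ _ → ⊤) (suc m)
  runs-select []       []       = runs-tick (runs-return tt)
  runs-select (z ∷ zs) (a ∷ as) = runs-tick (runs-map (runs-select zs as) _)

  runs-conjoin : ∀ {n m} (zs : Vec (Fin n) n) G (h : Hash n m) α →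
    Runs (conjoin zs G h α) (λ _ → ⊤) (suc (m * (2 + n)))
  runs-conjoin zs G []              []      = runs-tick (runs-return tt)
  runs-conjoin {n} {suc m} zs G ((a₀ ∷ as) ∷ h) (b ∷ α) = weaken
    (runs-tick (runs-bind (runs-select zs as) λ _ _ → runs-map (runs-conjoin zs G h α) _))
    (ℕ.≤-reflexive (conjoin-step n m))

  -- A doubling adds at most one digit and lowers `m` by one, so `s` bounds all intermediate sizes.
  runs-shift : ∀ {s} m x → ℕᵇ.size x + m ≤ s → Runs (shift m x) (λ y → ℕᵇ.size y ≤ s) (suc (m * suc s))
  runs-shift zero        x x≤s = runs-tick (runs-return (ℕ.≤-trans (ℕ.m≤m+n _ 0) x≤s))
  runs-shift {s} (suc m) x x≤s = weaken
    (runs-charge (s≤s (ℕ.≤-trans (ℕ.m≤m+n _ (suc m)) x≤s)) (runs-shift m (ℕᵇ.double x)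
      (ℕ.≤-trans (ℕ.+-monoˡ-≤ m (size-double x)) (subst (_≤ s) (ℕ.+-suc (ℕᵇ.size x) m) x≤s))))
    (ℕ.≤-reflexive (ℕ.+-suc (suc s) (m * suc s)))

  runs-toBinary : ∀ {s} k → k ≤ s → Runs (toBinary k) (λ x → ℕᵇ.size x ≤ k) (suc (k * (2 + s)))
  runs-toBinary zero        _   = runs-tick (runs-return z≤n)
  runs-toBinary {s} (suc k) k<s = weaken
    (runs-tick (runs-bind (runs-toBinary k (ℕ.<⇒≤ k<s)) λ x x≤k → runs-charge (s≤s (ℕ.≤-trans x≤k (ℕ.<⇒≤ k<s)))
      (runs-return (ℕ.≤-trans (size-suc x) (s≤s x≤k)))))
    (ℕ.≤-reflexive (toBinary-step k s))

  Small : ℕ → ℕᵇ → Set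
  Small s x = ℕᵇ.size x ≤ s

  runs-insert : ∀ {s x ys} → Small s x → All (Small s) ys →
    Runs (insert x ys) (λ zs → List.length zs ≡ suc (List.length ys) × All (Small s) zs)
      (suc (List.length ys) * suc (s + s))
  runs-insert x≤s [] = weaken (runs-tick (runs-return (refl , x≤s ∷ []))) (s≤s z≤n)
  runs-insert {s} {x} {y ∷ ys} x≤s (y≤s ∷ ys≤s) = runs-charge (s≤s (ℕ.+-mono-≤ x≤s y≤s)) (runs-if (does (x ≤?ᵇ y))
    (runs-return (refl , x≤s ∷ y≤s ∷ ys≤s))
    λ _ → runs-map (runs-insert x≤s ys≤s) λ zs (eq , zs≤s) → cong suc eq , y≤s ∷ zs≤s)

  -- The uniform bound `l` makes all insertions equally expensive, so that their costs add up to a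
  -- product.
  runs-sort : ∀ {s l xs} → All (Small s) xs → List.length xs ≤ l →
    Runs (sort xs) (λ ys → List.length ys ≡ List.length xs × All (Small s) ys)
      (suc (List.length xs * suc (l * suc (s + s))))
  runs-sort [] _ = runs-tick (runs-return (refl , []))
  runs-sort {s} {l} {x ∷ xs} (x≤s ∷ xs≤s) length<l = weaken
    (runs-tick (runs-bind (runs-sort xs≤s (ℕ.<⇒≤ length<l)) λ ys (eq , ys≤s) →
      weaken (runs-consequence (runs-insert x≤s ys≤s) (λ (eq′ , zs≤s) → trans eq′ (cong suc eq) , zs≤s))
        (ℕ.*-monoˡ-≤ (suc (s + s)) (subst (λ k → suc k ≤ l) (sym eq) length<l))))
    (ℕ.≤-reflexive (sort-step (List.length xs) (l * suc (s + s))))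

  runs-nth : ∀ k xs → Runs (nth k xs) (λ _ → ⊤) (suc (List.length xs))
  runs-nth k       []       = runs-tick (runs-return tt)
  runs-nth zero    (x ∷ xs) = weaken (runs-tick (runs-return tt)) (s≤s z≤n)
  runs-nth (suc k) (x ∷ xs) = runs-tick (runs-nth k xs)

  runs-median : ∀ {s l xs} → All (Small s) xs → List.length xs ≤ l →
    Runs (median xs) (λ _ → ⊤) (suc (l * suc (l * suc (s + s))) + (suc l + (suc l + suc l)))
  runs-median {s} {l} xs≤s length≤l =
    runs-bind (weaken (runs-sort xs≤s length≤l) (s≤s (ℕ.*-monoˡ-≤ (suc (l * suc (s + s))) length≤l))) λ ys (eq , _) →
    let ys≤l = ℕ.≤-trans (ℕ.≤-reflexive eq) length≤l in
    runs-bind (weaken (runs-length ys) (s≤s ys≤l)) λ { _ refl →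
    runs-charge (s≤s ys≤l) (weaken (runs-nth _ ys) (s≤s ys≤l)) }

  -- Cost of ApproxMCCore and of its repetitions

  module _ {n : ℕ} (F : CNF n) {N : ℕ} (∣F∣≤N : ∣ F ∣ ≤ N) (n≤N : n ≤ N) (pivot : ℕ) (1≤pivot : 1 ≤ pivot) where

    runs-boundedSAT′ : (zs : Vec (Fin n) n) → (∀ i → Vec.lookup zs i ≡ i) → ∀ G →
      Runs (boundedSAT zs G (suc pivot)) (λ S → List.length S ≤ suc pivot × List.length S ≤ 2 ^ n)
      (evalℕ (boundedSATCost (con N) (con pivot)) [])
    runs-boundedSAT′ zs zs≡ G = runs-consequence
      (weaken (runs-boundedSAT zs zs≡ G (suc pivot)) (s≤s (ℕ.*-monoʳ-≤ (suc pivot) (ℕ.+-monoʳ-≤ 3 n≤N))))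
      λ (length≤ , unique , _) → length≤ , unique-assignments-≤ unique

    runs-approxMCCore : Runs (approxMCCore F pivot) (Maybe.All (Small (suc pivot + N)))
      (evalℕ (coreCost (con N) (con pivot)) [])
    runs-approxMCCore =
      runs-bind (weaken (runs-variables n) (ℕ.*-mono-≤ (s≤s n≤N) (s≤s n≤N))) λ zs zs≡ →
      runs-bind (weaken (runs-toFormula F) (s≤s (ℕ.≤-trans (length-≤-size F) ∣F∣≤N))) λ G _ →
      runs-bind (runs-boundedSAT′ zs zs≡ G) λ S (S≤1+pivot , S≤2ⁿ) →
      runs-bind (weaken (runs-length S) (s≤s S≤1+pivot)) λ { _ refl →
      runs-charge (s≤s (ℕ.+-monoˡ-≤ pivot S≤1+pivot)) (
      runs-if (List.length S ≤ᵇ pivot)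
        (runs-map (weaken (runs-toBinary (List.length S) S≤1+pivot) (s≤s (ℕ.*-monoˡ-≤ (3 + pivot) S≤1+pivot)))
          λ x x≤s → Maybe.just (ℕ.≤-trans x≤s (ℕ.≤-trans S≤1+pivot (ℕ.m≤m+n _ N))))
        λ many →
          let l        = ⌊log₂ pivot ⌋ ∸ 1
              -- More than `pivot` distinct assignments have been found, out of `2 ^ n`.
              pivot<2ⁿ = ℕ.<-≤-trans (>ᵇ⇒> many) S≤2ⁿ
              l≤n      = ℕ.≤-trans (ℕ.m∸n≤m _ 1) (⌊log₂⌋-≤ (ℕ.<⇒≤ pivot<2ⁿ))
              -- The loop starts at `l ∸ 1`, since its body increments `i` first.
              start<n  = ℕ.≤-<-trans (ℕ.∸-monoˡ-≤ 1 l≤n) (n∸1<n 1≤pivot pivot<2ⁿ)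
          in
          runs-charge ℕ.≤-refl (
          runs-bind (weaken (runs-repeat {Q = λ (s , i) → s ≤ suc pivot × i ≤ n}
                                         {b = evalℕ (trialCost (con N) (con pivot)) []} (λ i i<n →
              -- Here `i` is the value before the increment, and `i<n` bounds the new value `suc i`
              -- by `n`.
              let i≤N = ℕ.≤-trans i<n n≤N
                  m≤N = ℕ.≤-trans (ℕ.m∸n≤m (suc i) l) i≤N
              in
              runs-charge (s≤s (ℕ.+-mono-≤ i≤N (ℕ.≤-trans l≤n n≤N))) (
              runs-bind (weaken (runs-randomHash n _)
                (s≤s (ℕ.*-mono-≤ m≤N (ℕ.+-monoʳ-≤ 4 (ℕ.*-monoˡ-≤ 2 n≤N))))) λ h _ →
              runs-bind (weaken (runs-randomBits _) (s≤s (ℕ.*-monoˡ-≤ 2 m≤N))) λ α _ →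
              runs-bind (weaken (runs-conjoin zs G h α) (s≤s (ℕ.*-mono-≤ m≤N (ℕ.+-monoʳ-≤ 2 n≤N)))) λ H _ →
              runs-bind (runs-boundedSAT′ zs zs≡ H) λ S (S≤1+pivot , _) →
              runs-bind (weaken (runs-length S) (s≤s S≤1+pivot)) λ { _ refl →
              weaken (runs-charge (s≤s (ℕ.+-mono-≤ (ℕ.+-mono-≤ (ℕ.+-monoˡ-≤ pivot S≤1+pivot) i≤N) n≤N))
                (runs-return (loop-exit ((1 ≤ᵇ List.length S) ∧ (List.length S ≤ᵇ pivot)) i<n (S≤1+pivot , i<n))))
                (ℕ.≤-reflexive (ℕ.+-identityʳ _)) }))
              -- From any start below `n`, at most `n` rounds remain.
              n _ start<n (ℕ.m≤n+m n _)) (ℕ.*-monoˡ-≤ _ n≤N))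
            λ { (s , i) (s≤1+pivot , i≤n) →
          let i≤N = ℕ.≤-trans i≤n n≤N in
          runs-charge (s≤s (ℕ.+-mono-≤ (ℕ.+-mono-≤ (ℕ.+-monoˡ-≤ pivot s≤1+pivot) i≤N) (ℕ.≤-trans l≤n n≤N))) (
          runs-if ((1 ≤ᵇ s) ∧ (s ≤ᵇ pivot))
            (runs-bind (weaken (runs-toBinary s s≤1+pivot) (s≤s (ℕ.*-monoˡ-≤ (3 + pivot) s≤1+pivot))) λ x x≤s →
              runs-map (weaken (runs-shift _ x (ℕ.+-mono-≤ (ℕ.≤-trans x≤s s≤1+pivot) (ℕ.≤-trans (ℕ.m∸n≤m i l) i≤N)))
                               (s≤s (ℕ.*-monoˡ-≤ (suc (suc pivot + N)) (ℕ.≤-trans (ℕ.m∸n≤m i l) i≤N))))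
                λ y → Maybe.just)
            λ _ → runs-return Maybe.nothing) })) }

    runs-collect : ∀ t → Runs (collect F pivot t)
      (λ C → List.length C ≤ t × All (Small (suc pivot + N)) C)
      (evalℕ (collectCost (con t) (con N) (con pivot)) [])
    runs-collect zero    = runs-tick (runs-return (z≤n , []))
    runs-collect (suc t) = weaken
      (runs-tick (runs-bind runs-approxMCCore λ r r≤s → runs-map (runs-collect t) λ C → add r≤s))
      (s≤s (ℕ.≤-reflexive (ℕ.+-suc (evalℕ (coreCost (con N) (con pivot)) []) _)))
      where
      add : ∀ {r C} → Maybe.All (Small (suc pivot + N)) r →
        List.length C ≤ t × All (Small (suc pivot + N)) C →
        List.length (Maybe.maybe′ (_∷ C) C r) ≤ suc t × All (Small (suc pivot + N)) (Maybe.maybe′ (_∷ C) C r)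
      add Maybe.nothing    (length≤ , C≤s) = ℕ.m≤n⇒m≤1+n length≤ , C≤s
      add (Maybe.just x≤s) (length≤ , C≤s) = s≤s length≤ , x≤s ∷ C≤s

  -- Cost of ApproxMC and the final bound

  runs-approxMC : ∀ {n} (F : CNF n) → (∀ v → v occursIn F) → ∀ {ε δ k t} →
    IsCeiling (halfPivot ε) k → IsCeiling (iterations δ) t →
    Runs (approxMC F ε δ) (λ _ → ⊤) (evalℕ (totalCost (con t) (con ∣ F ∣) (con k)) [])
  runs-approxMC F occurs {ε} {k = k} {t} hk ht =
    runs-charge ℕ.≤-refl (runs-bind (runs-ceil hk) λ { _ refl →
    runs-charge ℕ.≤-refl (runs-charge ℕ.≤-refl (runs-bind (runs-ceil ht) λ { _ refl →
    -- The bound `N` is `∣ F ∣` itself, for the size as well as for the number of variables.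
    runs-bind (runs-collect F ℕ.≤-refl (variables-≤-size F occurs) (2 * k)
      (ℕ.≤-trans (ceil-halfPivot-positive ε hk) (ℕ.m≤m+n k (k + 0))) t) λ C (length≤ , C≤s) →
    runs-median C≤s length≤ })) })

theorem4p3p5 : ∃ λ (p : Polynomial 3) →
    ∀ {n : ℕ} (F : CNF n) → (∀ (v : Fin n) → v occursIn F) →
    ∀ (ε δ : ℝ) → Positive ε → AtMostOne ε → Positive δ → AtMostOne δ →
    HasCeiling (halfPivot ε) → HasCeiling (iterations δ) →
    approxMC F ε δ runsInTime eval p (log₂ (recip δ) ∷ nat ∣ F ∣ ∷ recip ε ∷ [])
theorem4p3p5 = substitute cost params , λ F occurs ε δ _ _ _ _ (k , hk) (t , ht) O ω →
  let open Cost O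
      ρ = log₂ (recip δ) ∷ nat ∣ F ∣ ∷ recip ε ∷ []
      a , c , ω′ , run , _ , c≤ = runs-approxMC F occurs {ε} {δ} hk ht .halts ω
  -- The bound in `c≤`, with constants inserted, and `cost` evaluated at `t`, `∣ F ∣` and `k`
  -- compute to the same number.
  in a , c , ω′ , run , ≼-mono c≤ (evalℕ-≤-eval cost (t ∷ ∣ F ∣ ∷ k ∷ []) params ρ λ
    { zero             → iterations-≤ δ ht
    ; (suc zero)       → ≼-nat ∣ F ∣
    ; (suc (suc zero)) → halfPivot-≤ ε hk }) ._≼_.below
  where
  cost : Polynomial 3
  cost = totalCost (var zero) (var (suc zero)) (var (suc (suc zero)))
  params : Vec (Polynomial 3) 3
  -- The bounds of `iterations-≤` and `halfPivot-≤`, as polynomials in log₂ (1/δ), |F| and 1/ε.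
  params =
    (con 1 ⊞ con 35 ⊠ (con 2 ⊞ var zero)) ∷
    var (suc zero) ∷
    (con 1 ⊞ (con 3 ⊠ con 2) ⊠ (1+ 1/ε ⊠ 1+ 1/ε)) ∷ []
    where 1/ε = var (suc (suc zero))
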